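{- Let $\mathbb{F}$ be a field of characteristic zero. If $a(x) \in \mathbb{F}[[x]]$ is non-constant, $a(x) = a_0 + a_rx^r + a_{r+1}x^{r+1} + \cdots$ with $r > 0$ and $a_r \neq 0$, then $a(x)$ may be uniquely written as $$a(x) = a_0 + a_r\cdot\big(A(x)\big)^r$$ with $A(x)\in\mathbb{F}[[x]]$ of the form $A(x) = x + \cdots$ (zero constant term and coefficient of $x$ equal to $1$). Moreover, $A(x)$ has a compositional inverse $\overline{A}(x)$, which is also of the form $\overline{A}(x) = x + \cdots$.
   Context: $\mathbb{F}[[x]]$ is the ring of formal power series over $\mathbb{F}$. The compositional inverse of a series $A(x)$ with zero constant term and nonzero coefficient of $x$ is the series $\overline{A}(x)$ with $A(\overline{A}(x)) = \overline{A}(A(x)) = x$. -}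

module Defs where

open import Algebra.Apartness.Bundles using (HeytingField; HeytingCommutativeRing)
open import Algebra.Bundles using (CommutativeRing)
open import Algebra.Bundles.Raw using (RawSemiring)
import Algebra.Definitions.RawMonoid as RawMonoidDefinitions
import Algebra.Definitions.RawSemiring as RawSemiringDefinitions
open import Data.Fin.Base using (toℕ)
open import Data.Nat.Base using (ℕ; zero; suc; _∸_)
open import Data.Product.Base using (_×_)
open import Relation.Binary.Core using (Rel)

-- "Nonzero" is rendered throughout by the tight apartness of the field, i.e.
-- as x # 0#, which is equivalent to invertibility of x.  Classically it is
-- the same as ¬ (x ≈ 0#).
module PowerSeries {c ℓ₁ ℓ₂} (F : HeytingField c ℓ₁ ℓ₂) where

  open HeytingField F
  open CommutativeRing (HeytingCommutativeRing.commutativeRing heytingCommutativeRing)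
    using (+-rawMonoid)
  open RawMonoidDefinitions +-rawMonoid using (sum) renaming (_×_ to _×#_)

  -- n ×# 1# is the n-fold sum 1# + ⋯ + 1#.
  CharacteristicZero : Set ℓ₂
  CharacteristicZero = ∀ n → (suc n ×# 1#) # 0#

  -- A series is its sequence of coefficients: A n is the coefficient of xⁿ.
  Series : Set c
  Series = ℕ → Carrier

  infix 4 _≋_
  _≋_ : Rel Series ℓ₁
  A ≋ B = ∀ n → A n ≈ B n

  const : Carrier → Series
  const k zero    = k
  const k (suc _) = 0#

  X : Series
  X 0             = 0#
  X 1             = 1#
  X (suc (suc _)) = 0#

  infixl 6 _⊕_
  _⊕_ : Series → Series → Series
  (A ⊕ B) n = A n + B n

  infixl 7 _⊛_
  _⊛_ : Series → Series → Series
  (A ⊛ B) n = sum {suc n} λ i → A (toℕ i) * B (n ∸ toℕ i)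

  infixr 7 _·_
  _·_ : Carrier → Series → Series
  (k · A) n = k * A n

  seriesRawSemiring : RawSemiring c ℓ₁
  seriesRawSemiring = record
    { Carrier = Series
    ; _≈_     = _≋_
    ; _+_     = _⊕_
    ; _*_     = _⊛_
    ; 0#      = const 0#
    ; 1#      = const 1#
    }

  open RawSemiringDefinitions seriesRawSemiring public using (_^_)

  -- The composition A(B(x)) = Σₖ Aₖ B(x)ᵏ, meaningful only when B has zero
  -- constant term: then Bᵏ has no term of degree less than k, so only k ≤ n
  -- contribute to the coefficient of xⁿ.
  infixr 9 _⊚_
  _⊚_ : Series → Series → Series
  (A ⊚ B) n = sum {suc n} λ k → A (toℕ k) * (B ^ toℕ k) n

  StartsWithX : Series → Set ℓ₁
  StartsWithX A = A 0 ≈ 0# × A 1 ≈ 1#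

  -- The zero constant terms make both compositions below meaningful.
  record IsCompositionalInverse (A Ā : Series) : Set ℓ₁ where
    field
      A₀≈0 : A 0 ≈ 0#
      Ā₀≈0 : Ā 0 ≈ 0#
      A⊚Ā≋X : A ⊚ Ā ≋ X
      Ā⊚A≋X : Ā ⊚ A ≋ X

-- Writing A = x·A₁, the equation a = a₀ + aᵣ Aʳ becomes A₁ʳ = g with
-- g₀ = 1, and a right compositional inverse of A is a solution B of A(B) = X.
-- Both left hand sides are triangular in the unknown: the coefficient of xⁿ is
-- u times the n-th unknown coefficient plus a function of the earlier ones, with
-- u = r in the first case and u = 1 in the second, so that invertibility of u
-- gives existence and uniqueness. A right inverse B of A again has a
-- right inverse C, and A = A ∘ (B ∘ C) = (A ∘ B) ∘ C = C makes B two-sided.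
-- Multiplicativity and associativity of composition follow from Horner's rule
-- A(B) = A₀ + B · ((A − A₀)/x)(B): since B₀ = 0, each application gains one
-- correct coefficient.
module Submission where

open import Defs
open import Algebra.Apartness.Bundles using (HeytingField; HeytingCommutativeRing)
open import Algebra.Bundles using (CommutativeRing)
import Algebra.Definitions.RawMonoid as RawMonoidDefinitions
import Algebra.Properties.CommutativeMonoid.Sum as CommutativeMonoidSum
import Algebra.Properties.CommutativeSemigroup as CommutativeSemigroupProperties
import Algebra.Properties.Ring as RingProperties
import Algebra.Properties.Semiring.Sum as SemiringSum
open import Data.Fin.Base using (toℕ)
open import Data.Fin.Properties using (toℕ≤pred[n])
open import Data.Nat.Base as ℕ using (ℕ; zero; suc; _≤_; _<_; z≤n; s≤s)
import Data.Nat.Properties as ℕ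
open import Data.Product.Base using (∃-syntax; _×_; _,_; proj₁; proj₂)
open import Data.Product using (∃!)
open import Data.Sum.Base using (inj₁; inj₂)
open import Function.Base using (_∘_)
import Level
open import Relation.Binary.Bundles using (Setoid)
open import Relation.Binary.PropositionalEquality.Core as ≡ using ()
import Relation.Binary.Reasoning.Setoid as SetoidReasoning
open import Relation.Nullary.Decidable using (yes; no)

module SeriesProperties {c ℓ₁ ℓ₂} (F : HeytingField c ℓ₁ ℓ₂) where

  open HeytingField F
  open PowerSeries F
  open CommutativeRing (HeytingCommutativeRing.commutativeRing heytingCommutativeRing)
    using (ring; semiring; +-rawMonoid; +-commutativeMonoid; +-commutativeSemigroup; *-commutativeSemigroup)
  open RawMonoidDefinitions +-rawMonoid using (sum) renaming (_×_ to _×#_)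
  open RingProperties ring
    using (-0#≈0#; x∙y⁻¹≈ε⇒x≈y; x≈y⇒x∙y⁻¹≈ε; -‿+-comm; [y-z]x≈yx-zx; x[y-z]≈xy-xz; xyx⁻¹≈y; //-rightDividesˡ)
  open SemiringSum semiring using (*-distribˡ-sum; sum-cong-≋; sum-replicate-zero)
  open CommutativeMonoidSum +-commutativeMonoid using (∑-distrib-+)
  open CommutativeSemigroupProperties +-commutativeSemigroup using (interchange)
  open CommutativeSemigroupProperties *-commutativeSemigroup
    using () renaming (x∙yz≈y∙xz to x*yz≈y*xz)

  module ≈-Reasoning = SetoidReasoning setoid

  -- Differences and inverses in the field

  [x+y]-[x+z]≈y-z : ∀ x y z → (x + y) - (x + z) ≈ y - z
  [x+y]-[x+z]≈y-z x y z = begin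
    (x + y) + - (x + z)     ≈⟨ +-congˡ (-‿+-comm x z) ⟨
    (x + y) + (- x + - z)   ≈⟨ interchange x y (- x) (- z) ⟩
    (x + - x) + (y + - z)   ≈⟨ +-congʳ (-‿inverseʳ x) ⟩
    0# + (y + - z)          ≈⟨ +-identityˡ _ ⟩
    y - z                   ∎
    where open ≈-Reasoning

  [x-y]+[y-z]≈x-z : ∀ x y z → (x - y) + (y - z) ≈ x - z
  [x-y]+[y-z]≈x-z x y z =
    trans (sym (+-assoc (x - y) y (- z))) (+-congʳ (//-rightDividesˡ y x))

  minus-cong : ∀ {x x′ y y′} → x ≈ x′ → y ≈ y′ → x - y ≈ x′ - y′
  minus-cong p q = +-cong p (-‿cong q)

  invertible : ∀ {x} → x # 0# → ∃[ y ] y * x ≈ 1#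
  invertible {x} x#0 with #⇒invertible x#0
  ... | y , y[x-0]≈1 , _ =
    -- `#⇒invertible` inverts the difference `x - 0#`, which has to be rewritten to `x`.
    y , trans (*-congˡ (sym (trans (+-congˡ -0#≈0#) (+-identityʳ x)))) y[x-0]≈1

  cancel-invertible : ∀ {u v} → v * u ≈ 1# → ∀ x → v * (u * x) ≈ x
  cancel-invertible {u} {v} vu≈1 x =
    trans (sym (*-assoc v u x)) (trans (*-congʳ vu≈1) (*-identityˡ x))

  -- Coefficient shifts and congruence of series modulo powers of x

  tail : Series → Series
  tail A n = A (suc n)

  infixr 5 _◂_
  _◂_ : Carrier → Series → Series
  (k ◂ A) zero    = k
  (k ◂ A) (suc n) = A n

  tail-injective : ∀ A B → A 0 ≈ B 0 → tail A ≋ tail B → A ≋ B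
  tail-injective A B p q zero    = p
  tail-injective A B p q (suc n) = q n

  𝟘 : Series
  𝟘 _ = 0#

  infix 4 _≋[_]_
  -- Congruence modulo xⁿ. Equality of series is congruence for every n, which makes induction on n
  -- available.
  _≋[_]_ : Series → ℕ → Series → Set ℓ₁
  A ≋[ n ] B = ∀ i → i < n → A i ≈ B i

  agreementSetoid : ℕ → Setoid c ℓ₁
  agreementSetoid n = record
    { Carrier       = Series
    ; _≈_           = λ A B → A ≋[ n ] B
    ; isEquivalence = record
      { refl  = λ _ _ → refl
      ; sym   = λ p i i<n → sym (p i i<n)
      ; trans = λ p q i i<n → trans (p i i<n) (q i i<n)
      }
    }

  module Agreement n = SetoidReasoning (agreementSetoid n)

  ≋⇒≋[] : ∀ {A B} n → A ≋ B → A ≋[ n ] B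
  ≋⇒≋[] n A≋B i _ = A≋B i

  ≋[]⇒≋ : ∀ {A B} → (∀ n → A ≋[ n ] B) → A ≋ B
  ≋[]⇒≋ p n = p (suc n) n ℕ.≤-refl

  ≋[]-≤ : ∀ {A B m n} → m ≤ n → A ≋[ n ] B → A ≋[ m ] B
  ≋[]-≤ m≤n p i i<m = p i (ℕ.<-≤-trans i<m m≤n)

  ≋[]-suc : ∀ {A B n} → A ≋[ n ] B → A n ≈ B n → A ≋[ suc n ] B
  ≋[]-suc p q i (s≤s i≤n) with ℕ.m≤n⇒m<n∨m≡n i≤n
  ... | inj₁ i<n    = p i i<n
  ... | inj₂ ≡.refl = q

  ⊕-cong[] : ∀ {A A′ B B′ n} → A ≋[ n ] A′ → B ≋[ n ] B′ → A ⊕ B ≋[ n ] A′ ⊕ B′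
  ⊕-cong[] p q i i<n = +-cong (p i i<n) (q i i<n)

  ·-const : ∀ k l → k · const l ≋ const (k * l)
  ·-const k l zero    = refl
  ·-const k l (suc n) = zeroʳ k

  const-cong : ∀ {k l} → k ≈ l → const k ≋ const l
  const-cong k≈l zero    = k≈l
  const-cong k≈l (suc n) = refl

  ·-const-1 : ∀ k → k · const 1# ≋ const k
  ·-const-1 k n = trans (·-const k 1# n) (const-cong (*-identityʳ k) n)

  -- Finite sums and the Cauchy product

  sum-zero : ∀ {n} (f : ℕ → Carrier) → (∀ i → f i ≈ 0#) → sum {n} (f ∘ toℕ) ≈ 0#
  sum-zero {n} f f≈0 = trans (sum-cong-≋ {n} (f≈0 ∘ toℕ)) (sum-replicate-zero n)

  sum-truncate : ∀ {m n} (f : ℕ → Carrier) → m ≤ n → (∀ i → m ≤ i → f i ≈ 0#) →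
                 sum {n} (f ∘ toℕ) ≈ sum {m} (f ∘ toℕ)
  sum-truncate {n = n} f z≤n f≈0 = sum-zero {n} f (λ i → f≈0 i z≤n)
  sum-truncate f (s≤s m≤n) f≈0 =
    +-congˡ (sum-truncate (f ∘ suc) m≤n (λ i m≤i → f≈0 (suc i) (s≤s m≤i)))

  -- The inductions on Cauchy products use that, definitionally,
  -- tail (A ⊛ B) = A 0 · tail B ⊕ tail A ⊛ B.

  ⊛-cong[] : ∀ {A A′ B B′ n} → A ≋[ n ] A′ → B ≋[ n ] B′ → A ⊛ B ≋[ n ] A′ ⊛ B′
  ⊛-cong[] p q zero    (s≤s i<n) = +-congʳ (*-cong (p 0 (s≤s z≤n)) (q 0 (s≤s z≤n)))
  ⊛-cong[] p q (suc i) (s≤s i<n) =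
    +-cong (*-cong (p 0 (s≤s z≤n)) (q (suc i) (s≤s i<n)))
           (⊛-cong[] (λ j j<n → p (suc j) (s≤s j<n)) (≋[]-≤ (ℕ.n≤1+n _) q) i i<n)

  ⊛-cong : ∀ {A A′ B B′} → A ≋ A′ → B ≋ B′ → A ⊛ B ≋ A′ ⊛ B′
  ⊛-cong p q = ≋[]⇒≋ λ n → ⊛-cong[] (≋⇒≋[] n p) (≋⇒≋[] n q)

  ⊛-distribˡ-⊕ : ∀ A B C → A ⊛ (B ⊕ C) ≋ A ⊛ B ⊕ A ⊛ C
  ⊛-distribˡ-⊕ A B C n = trans (sum-cong-≋ {suc n} λ i → distribˡ (A (toℕ i)) (B (n ℕ.∸ toℕ i)) (C (n ℕ.∸ toℕ i)))
    (∑-distrib-+ {suc n} (λ i → A (toℕ i) * B (n ℕ.∸ toℕ i)) (λ i → A (toℕ i) * C (n ℕ.∸ toℕ i)))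

  ⊛-distribʳ-⊕ : ∀ A B C → (B ⊕ C) ⊛ A ≋ B ⊛ A ⊕ C ⊛ A
  ⊛-distribʳ-⊕ A B C n = trans (sum-cong-≋ {suc n} λ i → distribʳ (A (n ℕ.∸ toℕ i)) (B (toℕ i)) (C (toℕ i)))
    (∑-distrib-+ {suc n} (λ i → B (toℕ i) * A (n ℕ.∸ toℕ i)) (λ i → C (toℕ i) * A (n ℕ.∸ toℕ i)))

  ·-⊛-assoc : ∀ k A B → (k · A) ⊛ B ≋ k · (A ⊛ B)
  ·-⊛-assoc k A B n =
    trans (sum-cong-≋ {suc n} λ i → *-assoc k (A (toℕ i)) (B (n ℕ.∸ toℕ i)))
      (sym (*-distribˡ-sum {suc n} k (λ i → A (toℕ i) * B (n ℕ.∸ toℕ i))))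

  ⊛-·-comm : ∀ k A B → A ⊛ (k · B) ≋ k · (A ⊛ B)
  ⊛-·-comm k A B n =
    trans (sum-cong-≋ {suc n} λ i → x*yz≈y*xz (A (toℕ i)) k (B (n ℕ.∸ toℕ i)))
      (sym (*-distribˡ-sum {suc n} k (λ i → A (toℕ i) * B (n ℕ.∸ toℕ i))))

  ⊛-zeroˡ : ∀ A → 𝟘 ⊛ A ≋ 𝟘
  ⊛-zeroˡ A n = trans (sum-cong-≋ {suc n} λ i → zeroˡ (A (n ℕ.∸ toℕ i))) (sum-replicate-zero (suc n))

  ⊛-zeroʳ : ∀ A → A ⊛ 𝟘 ≋ 𝟘
  ⊛-zeroʳ A n = trans (sum-cong-≋ {suc n} λ i → zeroʳ (A (toℕ i))) (sum-replicate-zero (suc n))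

  const-⊛ : ∀ k A → const k ⊛ A ≋ k · A
  const-⊛ k A zero    = +-identityʳ _
  const-⊛ k A (suc n) = trans (+-congˡ (⊛-zeroˡ A n)) (+-identityʳ _)

  ⊛-identityʳ : ∀ A → A ⊛ const 1# ≋ A
  ⊛-identityʳ A zero    = trans (+-identityʳ _) (*-identityʳ _)
  ⊛-identityʳ A (suc n) = trans (+-cong (zeroʳ _) (⊛-identityʳ (tail A) n)) (+-identityˡ _)

  ⊛-head : ∀ A B → (A ⊛ B) 0 ≈ A 0 * B 0
  ⊛-head A B = +-identityʳ _

  ⊛-assoc : ∀ A B C → (A ⊛ B) ⊛ C ≋ A ⊛ (B ⊛ C)
  ⊛-assoc A B C zero = begin
    (A ⊛ B) 0 * C 0 + 0#     ≈⟨ +-congʳ (*-congʳ (⊛-head A B)) ⟩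
    A 0 * B 0 * C 0 + 0#     ≈⟨ +-congʳ (*-assoc _ _ _) ⟩
    A 0 * (B 0 * C 0) + 0#   ≈⟨ +-congʳ (*-congˡ (⊛-head B C)) ⟨
    A 0 * (B ⊛ C) 0 + 0#     ∎
    where open ≈-Reasoning
  ⊛-assoc A B C (suc n) = begin
    (A ⊛ B) 0 * C (suc n) + ((A 0 · tail B ⊕ tail A ⊛ B) ⊛ C) n
      ≈⟨ +-cong (trans (*-congʳ (⊛-head A B)) (*-assoc _ _ _)) (⊛-distribʳ-⊕ C (A 0 · tail B) (tail A ⊛ B) n) ⟩
    A 0 * (B 0 * C (suc n)) + (((A 0 · tail B) ⊛ C) n + ((tail A ⊛ B) ⊛ C) n)
      ≈⟨ +-congˡ (+-cong (·-⊛-assoc (A 0) (tail B) C n) (⊛-assoc (tail A) B C n)) ⟩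
    A 0 * (B 0 * C (suc n)) + (A 0 * (tail B ⊛ C) n + (tail A ⊛ (B ⊛ C)) n)
      ≈⟨ +-assoc _ _ _ ⟨
    A 0 * (B 0 * C (suc n)) + A 0 * (tail B ⊛ C) n + (tail A ⊛ (B ⊛ C)) n
      ≈⟨ +-congʳ (distribˡ _ _ _) ⟨
    A 0 * (B 0 * C (suc n) + (tail B ⊛ C) n) + (tail A ⊛ (B ⊛ C)) n ∎
    where open ≈-Reasoning

  ⊛-tailˡ : ∀ A → A 0 ≈ 0# → ∀ B → tail (A ⊛ B) ≋ tail A ⊛ B
  ⊛-tailˡ A A₀≈0 B n = trans (+-congʳ (trans (*-congʳ A₀≈0) (zeroˡ _))) (+-identityˡ _)

  ⊛-tailʳ : ∀ A B → B 0 ≈ 0# → tail (A ⊛ B) ≋ A ⊛ tail B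
  ⊛-tailʳ A B B₀≈0 zero    = +-congˡ (trans (+-identityʳ _) (trans (*-congˡ B₀≈0) (zeroʳ _)))
  ⊛-tailʳ A B B₀≈0 (suc n) = +-congˡ (⊛-tailʳ (tail A) B B₀≈0 n)

  ⊛-head-zero : ∀ A B → A 0 ≈ 0# → (A ⊛ B) 0 ≈ 0#
  ⊛-head-zero A B A₀≈0 = trans (⊛-head A B) (trans (*-congʳ A₀≈0) (zeroˡ _))

  -- A factor without constant term raises degrees by at least one, so degree n of the product sees
  -- the other factor only below degree n. This gain of one coefficient drives the inductions for
  -- multiplicativity and associativity of composition.
  ⊛-contraction : ∀ A {B C n} → A 0 ≈ 0# → B ≋[ n ] C → A ⊛ B ≋[ suc n ] A ⊛ C
  ⊛-contraction A {B} {C} A₀≈0 p zero    _         =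
    trans (⊛-head-zero A B A₀≈0) (sym (⊛-head-zero A C A₀≈0))
  ⊛-contraction A {B} {C} A₀≈0 p (suc i) (s≤s i<n) = begin
    (A ⊛ B) (suc i)   ≈⟨ ⊛-tailˡ A A₀≈0 B i ⟩
    (tail A ⊛ B) i    ≈⟨ ⊛-cong[] {tail A} (λ _ _ → refl) p i i<n ⟩
    (tail A ⊛ C) i    ≈⟨ ⊛-tailˡ A A₀≈0 C i ⟨
    (A ⊛ C) (suc i)   ∎
    where open ≈-Reasoning

  -- The difference of `A` and `B` is divisible by xⁿ, so in degree n only its leading coefficient
  -- meets `C`, at the constant term.
  ⊛-diffˡ : ∀ {A B n} C → A ≋[ n ] B → (A ⊛ C) n - (B ⊛ C) n ≈ (A n - B n) * C 0
  ⊛-diffˡ {A} {B} {zero} C p =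
    trans (minus-cong (⊛-head A C) (⊛-head B C)) (sym ([y-z]x≈yx-zx _ _ _))
  ⊛-diffˡ {A} {B} {suc n} C p = begin
    (A 0 * C (suc n) + (tail A ⊛ C) n) - (B 0 * C (suc n) + (tail B ⊛ C) n)
      ≈⟨ minus-cong (+-congʳ (*-congʳ (p 0 (s≤s z≤n)))) refl ⟩
    (B 0 * C (suc n) + (tail A ⊛ C) n) - (B 0 * C (suc n) + (tail B ⊛ C) n)
      ≈⟨ [x+y]-[x+z]≈y-z _ _ _ ⟩
    (tail A ⊛ C) n - (tail B ⊛ C) n
      ≈⟨ ⊛-diffˡ C (λ j j<n → p (suc j) (s≤s j<n)) ⟩
    (A (suc n) - B (suc n)) * C 0 ∎
    where open ≈-Reasoning

  ⊛-diffʳ : ∀ A {B C n} → B ≋[ n ] C → (A ⊛ B) n - (A ⊛ C) n ≈ A 0 * (B n - C n)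
  ⊛-diffʳ A {B} {C} {zero} p =
    trans (minus-cong (⊛-head A B) (⊛-head A C)) (sym (x[y-z]≈xy-xz _ _ _))
  ⊛-diffʳ A {B} {C} {suc n} p = begin
    (A 0 * B (suc n) + (tail A ⊛ B) n) - (A 0 * C (suc n) + (tail A ⊛ C) n)
      ≈⟨ minus-cong (trans (+-comm _ _) (+-congʳ tails)) (+-comm _ _) ⟩
    ((tail A ⊛ C) n + A 0 * B (suc n)) - ((tail A ⊛ C) n + A 0 * C (suc n))
      ≈⟨ [x+y]-[x+z]≈y-z _ _ _ ⟩
    A 0 * B (suc n) - A 0 * C (suc n)
      ≈⟨ x[y-z]≈xy-xz _ _ _ ⟨
    A 0 * (B (suc n) - C (suc n)) ∎
    where
    open ≈-Reasoning
    tails : (tail A ⊛ B) n ≈ (tail A ⊛ C) n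
    tails = ⊛-cong[] {tail A} (λ _ _ → refl) p n ℕ.≤-refl

  -- The series `λ m → B (k + m)` is `B` divided by xᵏ; the factor xᵏ is pulled out of the product
  -- one x at a time.
  ⊛-drop : ∀ A B k → B ≋[ k ] 𝟘 → ∀ n → (A ⊛ B) (k ℕ.+ n) ≈ (A ⊛ (λ m → B (k ℕ.+ m))) n
  ⊛-drop A B zero    p n = refl
  ⊛-drop A B (suc k) p n =
    trans (⊛-tailʳ A B (p 0 (s≤s z≤n)) (k ℕ.+ n))
          (⊛-drop A (tail B) k (λ i i<k → p (suc i) (s≤s i<k)) n)

  -- Powers

  ^-cong[] : ∀ {A B n} k → A ≋[ n ] B → A ^ k ≋[ n ] B ^ k
  ^-cong[] zero    p = λ _ _ → refl
  ^-cong[] (suc k) p = ⊛-cong[] p (^-cong[] k p)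

  ^-head : ∀ A k → A 0 ≈ 1# → (A ^ k) 0 ≈ 1#
  ^-head A zero    A₀≈1 = refl
  ^-head A (suc k) A₀≈1 =
    trans (⊛-head A (A ^ k)) (trans (*-cong A₀≈1 (^-head A k A₀≈1)) (*-identityʳ _))

  -- Each factor `A` contributes at least one x. This is what justifies cutting off the sum in
  -- `_⊚_`.
  ^-low : ∀ A k → A 0 ≈ 0# → A ^ k ≋[ k ] 𝟘
  ^-low A (suc k) A₀≈0 zero    _         = ⊛-head-zero A (A ^ k) A₀≈0
  ^-low A (suc k) A₀≈0 (suc i) (s≤s i<k) = begin
    (A ⊛ A ^ k) (suc i)   ≈⟨ ⊛-tailˡ A A₀≈0 (A ^ k) i ⟩
    (tail A ⊛ A ^ k) i    ≈⟨ ⊛-cong[] {tail A} (λ _ _ → refl) (^-low A k A₀≈0) i i<k ⟩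
    (tail A ⊛ 𝟘) i        ≈⟨ ⊛-zeroʳ (tail A) i ⟩
    0#                    ∎
    where open ≈-Reasoning

  -- With A = x · `tail A`, the k-th power is xᵏ times the k-th power of `tail A`.
  ^-tail : ∀ A k → A 0 ≈ 0# → ∀ n → (A ^ k) (k ℕ.+ n) ≈ (tail A ^ k) n
  ^-tail A zero    A₀≈0 n = refl
  ^-tail A (suc k) A₀≈0 n = begin
    (A ⊛ A ^ k) (suc k ℕ.+ n)
      ≈⟨ ⊛-tailˡ A A₀≈0 (A ^ k) (k ℕ.+ n) ⟩
    (tail A ⊛ A ^ k) (k ℕ.+ n)
      ≈⟨ ⊛-drop (tail A) (A ^ k) k (^-low A k A₀≈0) n ⟩
    (tail A ⊛ (λ m → (A ^ k) (k ℕ.+ m))) n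
      ≈⟨ ⊛-cong {tail A} (λ _ → refl) (^-tail A k A₀≈0) n ⟩
    (tail A ⊛ tail A ^ k) n ∎
    where open ≈-Reasoning

  -- k is the constant term of d(Bᵏ)/dB = k Bᵏ⁻¹, as B has constant term 1.
  ^-diff : ∀ k A B {n} → A 0 ≈ 1# → B 0 ≈ 1# → A ≋[ n ] B →
           (A ^ k) n - (B ^ k) n ≈ (k ×# 1#) * (A n - B n)
  ^-diff zero A B A₀≈1 B₀≈1 p = trans (-‿inverseʳ _) (sym (zeroˡ _))
  ^-diff (suc k) A B {n} A₀≈1 B₀≈1 p = begin
    (A ⊛ A ^ k) n - (B ⊛ B ^ k) n
      ≈⟨ [x-y]+[y-z]≈x-z _ _ _ ⟨
    ((A ⊛ A ^ k) n - (B ⊛ A ^ k) n) + ((B ⊛ A ^ k) n - (B ⊛ B ^ k) n)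
      ≈⟨ +-cong (⊛-diffˡ (A ^ k) p) (⊛-diffʳ B (^-cong[] k p)) ⟩
    (A n - B n) * (A ^ k) 0 + B 0 * ((A ^ k) n - (B ^ k) n)
      ≈⟨ +-cong (trans (*-congˡ (^-head A k A₀≈1)) (*-comm _ _)) (trans (*-congʳ B₀≈1) (*-identityˡ _)) ⟩
    1# * (A n - B n) + ((A ^ k) n - (B ^ k) n)
      ≈⟨ +-congˡ (^-diff k A B A₀≈1 B₀≈1 p) ⟩
    1# * (A n - B n) + (k ×# 1#) * (A n - B n)
      ≈⟨ distribʳ _ _ _ ⟨
    (suc k ×# 1#) * (A n - B n) ∎
    where open ≈-Reasoning

  -- Composition

  ⊚-head : ∀ A B → (A ⊚ B) 0 ≈ A 0
  ⊚-head A B = trans (+-identityʳ _) (*-identityʳ _)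

  ⊚-cong[] : ∀ {A A′ B B′ n} → A ≋[ n ] A′ → B ≋[ n ] B′ → A ⊚ B ≋[ n ] A′ ⊚ B′
  ⊚-cong[] p q i i<n = sum-cong-≋ {suc i} λ k →
    *-cong (p (toℕ k) (ℕ.≤-<-trans (toℕ≤pred[n] k) i<n)) (^-cong[] (toℕ k) q i i<n)

  ⊚-cong : ∀ {A A′ B B′} → A ≋ A′ → B ≋ B′ → A ⊚ B ≋ A′ ⊚ B′
  ⊚-cong p q = ≋[]⇒≋ λ n → ⊚-cong[] (≋⇒≋[] n p) (≋⇒≋[] n q)

  ⊚-distribʳ-⊕ : ∀ A B C → (A ⊕ B) ⊚ C ≋ A ⊚ C ⊕ B ⊚ C
  ⊚-distribʳ-⊕ A B C n = trans (sum-cong-≋ {suc n} λ k → distribʳ ((C ^ toℕ k) n) (A (toℕ k)) (B (toℕ k)))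
    (∑-distrib-+ {suc n} (λ k → A (toℕ k) * (C ^ toℕ k) n) (λ k → B (toℕ k) * (C ^ toℕ k) n))

  ·-⊚ : ∀ k A B → (k · A) ⊚ B ≋ k · (A ⊚ B)
  ·-⊚ k A B n = trans (sum-cong-≋ {suc n} λ i → *-assoc k (A (toℕ i)) ((B ^ toℕ i) n))
    (sym (*-distribˡ-sum {suc n} k (λ i → A (toℕ i) * (B ^ toℕ i) n)))

  const-⊚ : ∀ k A → const k ⊚ A ≋ const k
  const-⊚ k A n = begin
    k * const 1# n + sum {n} (λ i → 0# * (A ⊛ A ^ toℕ i) n)
      ≈⟨ +-cong (·-const-1 k n) (sum-zero {n} (λ i → 0# * (A ⊛ A ^ i) n) (λ i → zeroˡ ((A ⊛ A ^ i) n))) ⟩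
    const k n + 0#
      ≈⟨ +-identityʳ _ ⟩
    const k n ∎
    where open ≈-Reasoning

  ⊛-sum : ∀ A (f : ℕ → Series) N n →
          (A ⊛ (λ m → sum {N} (λ k → f (toℕ k) m))) n ≈ sum {N} (λ k → (A ⊛ f (toℕ k)) n)
  ⊛-sum A f zero    n = ⊛-zeroʳ A n
  ⊛-sum A f (suc N) n =
    trans (⊛-distribˡ-⊕ A (f 0) (λ m → sum {N} (λ k → f (suc (toℕ k)) m)) n) (+-congˡ (⊛-sum A (f ∘ suc) N n))

  -- All powers of `B` but the zeroth contain a factor `B`; pulling it out leaves the sum for
  -- `tail A`.
  horner : ∀ A B → B 0 ≈ 0# → A ⊚ B ≋ const (A 0) ⊕ B ⊛ (tail A ⊚ B)
  horner A B B₀≈0 zero = trans (⊚-head A B)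
    (sym (trans (+-congˡ (⊛-head-zero B (tail A ⊚ B) B₀≈0)) (+-identityʳ _)))
  horner A B B₀≈0 (suc n) = +-cong (zeroʳ _) (begin
    sum {suc n} (λ k → tail A (toℕ k) * (B ⊛ B ^ toℕ k) (suc n))
      ≈⟨ sum-cong-≋ {suc n} (λ k → *-congˡ {tail A (toℕ k)} (⊛-tailˡ B B₀≈0 (B ^ toℕ k) n)) ⟩
    sum {suc n} (λ k → tail A (toℕ k) * (tail B ⊛ B ^ toℕ k) n)
      ≈⟨ sum-cong-≋ {suc n} (λ k → ⊛-·-comm (tail A (toℕ k)) (tail B) (B ^ toℕ k) n) ⟨
    sum {suc n} (λ k → (tail B ⊛ (tail A (toℕ k) · B ^ toℕ k)) n)
      ≈⟨ ⊛-sum (tail B) (λ k → tail A k · B ^ k) (suc n) n ⟨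
    (tail B ⊛ (λ m → sum {suc n} (λ k → tail A (toℕ k) * (B ^ toℕ k) m))) n
      ≈⟨ ⊛-cong[] {tail B} (λ _ _ → refl) truncation n ℕ.≤-refl ⟩
    (tail B ⊛ (tail A ⊚ B)) n
      ≈⟨ ⊛-tailˡ B B₀≈0 (tail A ⊚ B) n ⟨
    (B ⊛ (tail A ⊚ B)) (suc n) ∎)
    where
    open ≈-Reasoning
    -- Linearity of the product needs the same number of summands in every degree, so the cutoff is
    -- frozen at `suc n`. In degree m ≤ n the surplus summands have k > m and vanish, because Bᵏ is
    -- divisible by xᵏ.
    truncation : (λ m → sum {suc n} (λ k → tail A (toℕ k) * (B ^ toℕ k) m)) ≋[ suc n ] tail A ⊚ B
    truncation m m<1+n = sum-truncate (λ k → tail A k * (B ^ k) m) m<1+n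
      (λ k m<k → trans (*-congˡ (^-low B k B₀≈0 m m<k)) (zeroʳ _))

  tail-X : tail X ≋ const 1#
  tail-X zero    = refl
  tail-X (suc _) = refl

  ⊚-identityʳ : ∀ A → A ⊚ X ≋ A
  ⊚-identityʳ A zero    = ⊚-head A X
  ⊚-identityʳ A (suc n) = begin
    (A ⊚ X) (suc n)                  ≈⟨ horner A X refl (suc n) ⟩
    0# + (X ⊛ (tail A ⊚ X)) (suc n)  ≈⟨ +-identityˡ _ ⟩
    (X ⊛ (tail A ⊚ X)) (suc n)       ≈⟨ ⊛-tailˡ X refl (tail A ⊚ X) n ⟩
    (tail X ⊛ (tail A ⊚ X)) n        ≈⟨ ⊛-cong {B = tail A ⊚ X} tail-X (λ _ → refl) n ⟩
    (const 1# ⊛ (tail A ⊚ X)) n      ≈⟨ const-⊛ 1# (tail A ⊚ X) n ⟩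
    1# * (tail A ⊚ X) n              ≈⟨ *-identityˡ _ ⟩
    (tail A ⊚ X) n                   ≈⟨ ⊚-identityʳ (tail A) n ⟩
    A (suc n)                        ∎
    where open ≈-Reasoning

  ⊚-identityˡ : ∀ A → A 0 ≈ 0# → X ⊚ A ≋ A
  ⊚-identityˡ A A₀≈0 n = begin
    (X ⊚ A) n                            ≈⟨ horner X A A₀≈0 n ⟩
    const 0# n + (A ⊛ (tail X ⊚ A)) n    ≈⟨ +-cong (const-0 n) (⊛-cong {A} (λ _ → refl) tail-X⊚A n) ⟩
    0# + (A ⊛ const 1#) n                ≈⟨ +-identityˡ _ ⟩
    (A ⊛ const 1#) n                     ≈⟨ ⊛-identityʳ A n ⟩
    A n                                  ∎
    where
    open ≈-Reasoning
    const-0 : const 0# ≋ 𝟘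
    const-0 zero    = refl
    const-0 (suc _) = refl
    tail-X⊚A : tail X ⊚ A ≋ const 1#
    tail-X⊚A m = trans (⊚-cong {B = A} tail-X (λ _ → refl) m) (const-⊚ 1# A m)

  -- Horner's rule for `A ⊛ B` leaves the tail `A 0 · tail B ⊕ tail A ⊛ B`, in which only the second
  -- summand needs the induction hypothesis, at `tail A`; hence the quantification over `A` inside
  -- the induction. The factor `C` then gains the missing coefficient.
  ⊚-distribʳ-⊛[] : ∀ C → C 0 ≈ 0# → ∀ n A B → (A ⊛ B) ⊚ C ≋[ n ] (A ⊚ C) ⊛ (B ⊚ C)
  ⊚-distribʳ-⊛[] C C₀≈0 zero A B i ()
  ⊚-distribʳ-⊛[] C C₀≈0 (suc n) A B = begin
    (A ⊛ B) ⊚ C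
      ≈⟨ ≋⇒≋[] (suc n) (horner (A ⊛ B) C C₀≈0) ⟩
    const ((A ⊛ B) 0) ⊕ C ⊛ ((A 0 · tail B ⊕ tail A ⊛ B) ⊚ C)
      ≈⟨ ⊕-cong[] {const ((A ⊛ B) 0)} (≋⇒≋[] (suc n) (const-cong (⊛-head A B))) (⊛-contraction C C₀≈0 tails) ⟩
    const (A 0 * B 0) ⊕ C ⊛ (A 0 · (tail B ⊚ C) ⊕ (tail A ⊚ C) ⊛ (B ⊚ C))
      ≈⟨ ≋⇒≋[] (suc n) rearrange ⟩
    A 0 · (const (B 0) ⊕ C ⊛ (tail B ⊚ C)) ⊕ (C ⊛ (tail A ⊚ C)) ⊛ (B ⊚ C)
      ≈⟨ ≋⇒≋[] (suc n) (λ m → +-congʳ (*-congˡ (sym (horner B C C₀≈0 m)))) ⟩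
    A 0 · (B ⊚ C) ⊕ (C ⊛ (tail A ⊚ C)) ⊛ (B ⊚ C)
      ≈⟨ ≋⇒≋[] (suc n) (λ m → +-congʳ (sym (const-⊛ (A 0) (B ⊚ C) m))) ⟩
    const (A 0) ⊛ (B ⊚ C) ⊕ (C ⊛ (tail A ⊚ C)) ⊛ (B ⊚ C)
      ≈⟨ ≋⇒≋[] (suc n) (⊛-distribʳ-⊕ (B ⊚ C) (const (A 0)) (C ⊛ (tail A ⊚ C))) ⟨
    (const (A 0) ⊕ C ⊛ (tail A ⊚ C)) ⊛ (B ⊚ C)
      ≈⟨ ≋⇒≋[] (suc n) (⊛-cong {B = B ⊚ C} (horner A C C₀≈0) (λ _ → refl)) ⟨
    (A ⊚ C) ⊛ (B ⊚ C) ∎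
    where
    open Agreement (suc n)
    tails : (A 0 · tail B ⊕ tail A ⊛ B) ⊚ C ≋[ n ] A 0 · (tail B ⊚ C) ⊕ (tail A ⊚ C) ⊛ (B ⊚ C)
    tails i i<n = trans (⊚-distribʳ-⊕ (A 0 · tail B) (tail A ⊛ B) C i)
      (+-cong (·-⊚ (A 0) (tail B) C i) (⊚-distribʳ-⊛[] C C₀≈0 n (tail A) B i i<n))
    rearrange : const (A 0 * B 0) ⊕ C ⊛ (A 0 · (tail B ⊚ C) ⊕ (tail A ⊚ C) ⊛ (B ⊚ C)) ≋
                A 0 · (const (B 0) ⊕ C ⊛ (tail B ⊚ C)) ⊕ (C ⊛ (tail A ⊚ C)) ⊛ (B ⊚ C)
    rearrange m = R.begin
      const (A 0 * B 0) m + (C ⊛ (A 0 · (tail B ⊚ C) ⊕ (tail A ⊚ C) ⊛ (B ⊚ C))) m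
        R.≈⟨ +-congˡ (⊛-distribˡ-⊕ C (A 0 · (tail B ⊚ C)) ((tail A ⊚ C) ⊛ (B ⊚ C)) m) ⟩
      const (A 0 * B 0) m + ((C ⊛ (A 0 · (tail B ⊚ C))) m + (C ⊛ ((tail A ⊚ C) ⊛ (B ⊚ C))) m)
        R.≈⟨ +-cong (sym (·-const (A 0) (B 0) m)) (+-cong (⊛-·-comm (A 0) C (tail B ⊚ C) m) (sym (⊛-assoc C (tail A ⊚ C) (B ⊚ C) m))) ⟩
      A 0 * const (B 0) m + (A 0 * (C ⊛ (tail B ⊚ C)) m + ((C ⊛ (tail A ⊚ C)) ⊛ (B ⊚ C)) m)
        R.≈⟨ +-assoc _ _ _ ⟨
      A 0 * const (B 0) m + A 0 * (C ⊛ (tail B ⊚ C)) m + ((C ⊛ (tail A ⊚ C)) ⊛ (B ⊚ C)) m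
        R.≈⟨ +-congʳ (distribˡ _ _ _) ⟨
      A 0 * (const (B 0) m + (C ⊛ (tail B ⊚ C)) m) + ((C ⊛ (tail A ⊚ C)) ⊛ (B ⊚ C)) m R.∎
      where module R = ≈-Reasoning

  ⊚-distribʳ-⊛ : ∀ C → C 0 ≈ 0# → ∀ A B → (A ⊛ B) ⊚ C ≋ (A ⊚ C) ⊛ (B ⊚ C)
  ⊚-distribʳ-⊛ C C₀≈0 A B = ≋[]⇒≋ λ n → ⊚-distribʳ-⊛[] C C₀≈0 n A B

  -- Horner's rule for `A` reduces both sides to `tail A`: multiplicativity carries the composition
  -- with `C` past the factor `B`, and the resulting factor `B ⊚ C` gains one coefficient.
  ⊚-assoc[] : ∀ B C → B 0 ≈ 0# → C 0 ≈ 0# → ∀ n A → (A ⊚ B) ⊚ C ≋[ n ] A ⊚ (B ⊚ C)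
  ⊚-assoc[] B C B₀≈0 C₀≈0 zero    A i ()
  ⊚-assoc[] B C B₀≈0 C₀≈0 (suc n) A = begin
    (A ⊚ B) ⊚ C
      ≈⟨ ≋⇒≋[] (suc n) (⊚-cong {B = C} (horner A B B₀≈0) (λ _ → refl)) ⟩
    (const (A 0) ⊕ B ⊛ (tail A ⊚ B)) ⊚ C
      ≈⟨ ≋⇒≋[] (suc n) (⊚-distribʳ-⊕ (const (A 0)) (B ⊛ (tail A ⊚ B)) C) ⟩
    const (A 0) ⊚ C ⊕ (B ⊛ (tail A ⊚ B)) ⊚ C
      ≈⟨ ≋⇒≋[] (suc n) (λ m → +-cong (const-⊚ (A 0) C m) (⊚-distribʳ-⊛ C C₀≈0 B (tail A ⊚ B) m)) ⟩
    const (A 0) ⊕ (B ⊚ C) ⊛ ((tail A ⊚ B) ⊚ C)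
      ≈⟨ ⊕-cong[] {const (A 0)} (λ _ _ → refl) (⊛-contraction (B ⊚ C) B⊚C₀≈0 (⊚-assoc[] B C B₀≈0 C₀≈0 n (tail A))) ⟩
    const (A 0) ⊕ (B ⊚ C) ⊛ (tail A ⊚ (B ⊚ C))
      ≈⟨ ≋⇒≋[] (suc n) (horner A (B ⊚ C) B⊚C₀≈0) ⟨
    A ⊚ (B ⊚ C) ∎
    where
    open Agreement (suc n)
    B⊚C₀≈0 : (B ⊚ C) 0 ≈ 0#
    B⊚C₀≈0 = trans (⊚-head B C) B₀≈0

  ⊚-assoc : ∀ B C → B 0 ≈ 0# → C 0 ≈ 0# → ∀ A → (A ⊚ B) ⊚ C ≋ A ⊚ (B ⊚ C)
  ⊚-assoc B C B₀≈0 C₀≈0 A = ≋[]⇒≋ λ n → ⊚-assoc[] B C B₀≈0 C₀≈0 n A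

  -- Horner's rule with one x cancelled.
  ⊚-suc : ∀ A B → B 0 ≈ 0# → tail (A ⊚ B) ≋ tail B ⊛ (tail A ⊚ B)
  ⊚-suc A B B₀≈0 n =
    trans (horner A B B₀≈0 (suc n)) (trans (+-identityˡ _) (⊛-tailˡ B B₀≈0 (tail A ⊚ B) n))

  -- To first order the difference is A′(0) (B - C), and A′(0) is the coefficient `A 1`. The factor
  -- `1#` is kept as the slope required by `Triangular`.
  ⊚-diff : ∀ A {B C n} → A 1 ≈ 1# → B 0 ≈ 0# → C 0 ≈ 0# → B ≋[ suc n ] C →
           (A ⊚ B) (suc n) - (A ⊚ C) (suc n) ≈ 1# * (B (suc n) - C (suc n))
  ⊚-diff A {B} {C} {n} A₁≈1 B₀≈0 C₀≈0 p = begin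
    (A ⊚ B) (suc n) - (A ⊚ C) (suc n)
      -- The factor `tail A ⊚ C` matters only up to degree n, where it agrees with `tail A ⊚ B`.
      ≈⟨ minus-cong (⊚-suc A B B₀≈0 n)
           (trans (⊚-suc A C C₀≈0 n) (sym (⊛-cong[] {tail C} (λ _ _ → refl) (⊚-cong[] {tail A} (λ _ _ → refl) p) n ℕ.≤-refl))) ⟩
    (tail B ⊛ (tail A ⊚ B)) n - (tail C ⊛ (tail A ⊚ B)) n
      ≈⟨ ⊛-diffˡ (tail A ⊚ B) (λ j j<n → p (suc j) (s≤s j<n)) ⟩
    (B (suc n) - C (suc n)) * (tail A ⊚ B) 0
      ≈⟨ trans (*-congˡ (trans (⊚-head (tail A) B) A₁≈1)) (*-comm _ _) ⟩
    1# * (B (suc n) - C (suc n)) ∎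
    where open ≈-Reasoning

  -- Triangular equations

  -- Stated through differences, so that the contribution of the earlier coefficients need not be
  -- named. The constant term `b` is fixed because the slope may depend on it: for the k-th power it
  -- is k bᵏ⁻¹.
  Triangular : (Series → Series) → Carrier → Carrier → Set (c Level.⊔ ℓ₁)
  Triangular Φ b u = ∀ A B {n} → A 0 ≈ b → B 0 ≈ b → A ≋[ suc n ] B →
                     Φ A (suc n) - Φ B (suc n) ≈ u * (A (suc n) - B (suc n))

  module _ Φ {b u} (triangular : Triangular Φ b u) {v} (vu≈1 : v * u ≈ 1#) where

    -- By induction on the degree: when `A` and `B` agree up to degree n, their images differ in the
    -- next degree by `u` times the difference of the next coefficients, and `v` cancels `u`.
    triangular-injective : ∀ A B → A 0 ≈ b → B 0 ≈ b → Φ A ≋ Φ B → A ≋ B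
    triangular-injective A B A₀≈b B₀≈b ΦA≋ΦB = ≋[]⇒≋ λ { zero i () ; (suc n) → agree n }
      where
      agree : ∀ n → A ≋[ suc n ] B
      agree zero    = ≋[]-suc (λ _ ()) (trans A₀≈b (sym B₀≈b))
      agree (suc n) = ≋[]-suc (agree n) (x∙y⁻¹≈ε⇒x≈y _ _ (begin
        A (suc n) - B (suc n)               ≈⟨ cancel-invertible vu≈1 _ ⟨
        v * (u * (A (suc n) - B (suc n)))   ≈⟨ *-congˡ (triangular A B A₀≈b B₀≈b (agree n)) ⟨
        v * (Φ A (suc n) - Φ B (suc n))     ≈⟨ *-congˡ (x≈y⇒x∙y⁻¹≈ε (ΦA≋ΦB (suc n))) ⟩
        v * 0#                              ≈⟨ zeroʳ v ⟩
        0#                                  ∎))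
        where open ≈-Reasoning

    -- Newton's iteration with the constant slope u: each step makes at least
    -- one more coefficient of Φ A agree with g.
    module _ (g : Series) (Φ-head : ∀ A → A 0 ≈ b → Φ A 0 ≈ g 0) where

      iterate : ℕ → Series
      iterate zero    = const b
      iterate (suc n) = iterate n ⊕ v · (λ i → g i - Φ (iterate n) i)

      step-fixed : ∀ n {i} → Φ (iterate n) i ≈ g i → iterate (suc n) i ≈ iterate n i
      step-fixed n {i} p = begin
        iterate n i + v * (g i - Φ (iterate n) i)  ≈⟨ +-congˡ (*-congˡ (x≈y⇒x∙y⁻¹≈ε (sym p))) ⟩
        iterate n i + v * 0#                       ≈⟨ +-congˡ (zeroʳ v) ⟩
        iterate n i + 0#                           ≈⟨ +-identityʳ _ ⟩
        iterate n i                                ∎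
        where open ≈-Reasoning

      iterate-head : ∀ n → iterate n 0 ≈ b
      iterate-head zero    = refl
      iterate-head (suc n) = trans (step-fixed n (Φ-head (iterate n) (iterate-head n))) (iterate-head n)

      -- Mutual induction: solved coefficients receive no correction and stay put; while the lower
      -- ones stay put, correcting the next one by `v` times its defect changes its image by exactly
      -- the defect.
      iterate-solves : ∀ n → Φ (iterate n) ≋[ suc n ] g
      iterate-stable : ∀ n → iterate (suc n) ≋[ suc n ] iterate n

      iterate-solves n       zero    _         = Φ-head (iterate n) (iterate-head n)
      iterate-solves (suc n) (suc i) (s≤s i<n) = x∙y⁻¹≈ε⇒x≈y _ _ (begin
        Φ B (suc i) - g (suc i)
          ≈⟨ [x-y]+[y-z]≈x-z _ _ _ ⟨
        (Φ B (suc i) - Φ A (suc i)) + (Φ A (suc i) - g (suc i))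
          ≈⟨ +-congʳ (triangular B A (iterate-head (suc n)) (iterate-head n) (≋[]-≤ i<n (iterate-stable n))) ⟩
        u * (B (suc i) - A (suc i)) + (Φ A (suc i) - g (suc i))
          -- By definition `B` is `A` plus the correction, so subtracting `A` leaves the correction.
          ≈⟨ +-congʳ (*-congˡ (xyx⁻¹≈y _ _)) ⟩
        u * (v * (g (suc i) - Φ A (suc i))) + (Φ A (suc i) - g (suc i))
          ≈⟨ +-congʳ (cancel-invertible (trans (*-comm u v) vu≈1) _) ⟩
        (g (suc i) - Φ A (suc i)) + (Φ A (suc i) - g (suc i))
          ≈⟨ [x-y]+[y-z]≈x-z _ _ _ ⟩
        g (suc i) - g (suc i)
          ≈⟨ -‿inverseʳ _ ⟩
        0# ∎)
        where
        open ≈-Reasoning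
        A B : Series
        A = iterate n
        B = iterate (suc n)

      iterate-stable n i i<1+n = step-fixed n (iterate-solves n i i<1+n)

      -- The x-adic limit of the iterates: coefficient n no longer changes from `iterate n` on.
      solution : Series
      solution n = iterate n n

      solution≋iterate : ∀ n → solution ≋[ suc n ] iterate n
      solution≋iterate zero    zero (s≤s z≤n) = refl
      solution≋iterate (suc n) = ≋[]-suc
        (λ i i<1+n → trans (solution≋iterate n i i<1+n) (sym (iterate-stable n i i<1+n))) refl

      solution-solves : Φ solution ≋ g
      solution-solves zero    = Φ-head solution refl
      solution-solves (suc n) = trans (x∙y⁻¹≈ε⇒x≈y _ _ (begin
        Φ solution (suc n) - Φ (iterate (suc n)) (suc n)
          ≈⟨ triangular solution (iterate (suc n)) refl (iterate-head (suc n)) (≋[]-≤ (ℕ.n≤1+n _) (solution≋iterate (suc n))) ⟩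
        -- By definition `iterate (suc n) (suc n)` is `solution (suc n)`.
        u * (solution (suc n) - solution (suc n))
          ≈⟨ *-congˡ (-‿inverseʳ _) ⟩
        u * 0#
          ≈⟨ zeroʳ u ⟩
        0# ∎)) (iterate-solves (suc n) (suc n) ℕ.≤-refl)
        where open ≈-Reasoning

  -- Compositional inverses

  right-inverse : ∀ A → StartsWithX A → ∃[ B ] StartsWithX B × A ⊚ B ≋ X
  right-inverse A (A₀≈0 , A₁≈1) = B , (refl , B₁≈1) , A⊚B≋X
    where
    open ≈-Reasoning
    triangular : Triangular (A ⊚_) 0# 1#
    triangular B C = ⊚-diff A {B} {C} A₁≈1
    Φ-head : ∀ B → B 0 ≈ 0# → (A ⊚ B) 0 ≈ 0#
    Φ-head B _ = trans (⊚-head A B) A₀≈0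
    B : Series
    B = solution (A ⊚_) triangular (*-identityˡ 1#) X Φ-head
    A⊚B≋X : A ⊚ B ≋ X
    A⊚B≋X = solution-solves (A ⊚_) triangular (*-identityˡ 1#) X Φ-head
    -- The iteration prescribes only the constant term of `B`; the coefficient of x is read off from
    -- A(B) = X in degree 1, where the left side is `B 1 * A 1`.
    B₁≈1 : B 1 ≈ 1#
    B₁≈1 = begin
      B 1                          ≈⟨ *-identityʳ _ ⟨
      B 1 * 1#                     ≈⟨ *-congˡ (trans (⊚-head (tail A) B) A₁≈1) ⟨
      B 1 * (tail A ⊚ B) 0         ≈⟨ ⊛-head (tail B) (tail A ⊚ B) ⟨
      (tail B ⊛ (tail A ⊚ B)) 0    ≈⟨ ⊚-suc A B refl 0 ⟨
      (A ⊚ B) 1                    ≈⟨ A⊚B≋X 1 ⟩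
      1#                           ∎

  inverse-sym : ∀ A B C → A 0 ≈ 0# → B 0 ≈ 0# → C 0 ≈ 0# → A ⊚ B ≋ X → B ⊚ C ≋ X → B ⊚ A ≋ X
  inverse-sym A B C A₀≈0 B₀≈0 C₀≈0 A⊚B≋X B⊚C≋X n =
    trans (⊚-cong {B} (λ _ → refl) A≋C n) (B⊚C≋X n)
    where
    open ≈-Reasoning
    A≋C : A ≋ C
    A≋C n = begin
      A n               ≈⟨ ⊚-identityʳ A n ⟨
      (A ⊚ X) n         ≈⟨ ⊚-cong {A} (λ _ → refl) B⊚C≋X n ⟨
      (A ⊚ (B ⊚ C)) n   ≈⟨ ⊚-assoc B C B₀≈0 C₀≈0 A n ⟨
      ((A ⊚ B) ⊚ C) n   ≈⟨ ⊚-cong {B = C} A⊚B≋X (λ _ → refl) n ⟩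
      (X ⊚ C) n         ≈⟨ ⊚-identityˡ C C₀≈0 n ⟩
      C n               ∎

  compositional-inverse : ∀ A → StartsWithX A → ∃[ Ā ] IsCompositionalInverse A Ā × StartsWithX Ā
  compositional-inverse A startsWithX =
    let B , startsWithX′ , A⊚B≋X = right-inverse A startsWithX
        C , startsWithX″ , B⊚C≋X = right-inverse B startsWithX′
        A₀≈0 = proj₁ startsWithX
        B₀≈0 = proj₁ startsWithX′
        C₀≈0 = proj₁ startsWithX″
    in B , record
         { A₀≈0  = A₀≈0
         ; Ā₀≈0  = B₀≈0
         ; A⊚Ā≋X = A⊚B≋X
         ; Ā⊚A≋X = inverse-sym A B C A₀≈0 B₀≈0 C₀≈0 A⊚B≋X B⊚C≋X
         } , startsWithX′

  -- Roots of series with constant term 1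

  power-triangular : ∀ k → Triangular (_^ k) 1# (k ×# 1#)
  power-triangular k A B {n} A₀≈1 B₀≈1 = ^-diff k A B {suc n} A₀≈1 B₀≈1

  module _ (charZero : CharacteristicZero) where

    -- Characteristic zero makes the slope `suc k ×# 1#` of the power map invertible.
    root-unique : ∀ k A B → A 0 ≈ 1# → B 0 ≈ 1# → A ^ suc k ≋ B ^ suc k → A ≋ B
    root-unique k =
      triangular-injective (_^ suc k) (power-triangular (suc k)) (proj₂ (invertible (charZero k)))

    root : ∀ k g → g 0 ≈ 1# → ∃[ A ] A 0 ≈ 1# × A ^ suc k ≋ g
    root k g g₀≈1 = solution Φ triangular vu≈1 g Φ-head , refl , solution-solves Φ triangular vu≈1 g Φ-head
      where
      Φ : Series → Series
      Φ A = A ^ suc k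
      triangular : Triangular Φ 1# (suc k ×# 1#)
      triangular = power-triangular (suc k)
      vu≈1 : proj₁ (invertible (charZero k)) * (suc k ×# 1#) ≈ 1#
      vu≈1 = proj₂ (invertible (charZero k))
      Φ-head : ∀ A → A 0 ≈ 1# → (A ^ suc k) 0 ≈ g 0
      Φ-head A A₀≈1 = trans (^-head A (suc k) A₀≈1) (sym g₀≈1)

  -- Translation between the expansion of a and an r-th root

  module _ (a : Series) k w (wa≈1 : w * a (suc k) ≈ 1#) where

    private
      r = suc k

    -- With `w` the inverse of aᵣ and no terms of `a` strictly between degrees 0 and r, this is (a -
    -- a₀) / (aᵣ xʳ).
    shifted : Series
    shifted n = w * a (r ℕ.+ n)

    shifted-head : shifted 0 ≈ 1#
    shifted-head = trans (*-congˡ (reflexive (≡.cong a (ℕ.+-identityʳ r)))) wa≈1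

    -- Comparison in degrees r and above: there `const (a 0)` vanishes since r > 0, and Aʳ is xʳ
    -- times the r-th power of `tail A`.
    expansion⇒root : ∀ A → A 0 ≈ 0# → a ≋ const (a 0) ⊕ a r · A ^ r → tail A ^ r ≋ shifted
    expansion⇒root A A₀≈0 a≋ n = begin
      (tail A ^ r) n                    ≈⟨ ^-tail A r A₀≈0 n ⟨
      (A ^ r) (r ℕ.+ n)                 ≈⟨ cancel-invertible wa≈1 _ ⟨
      w * (a r * (A ^ r) (r ℕ.+ n))     ≈⟨ *-congˡ (trans (a≋ (r ℕ.+ n)) (+-identityˡ _)) ⟨
      shifted n                         ∎
      where open ≈-Reasoning

    -- Three ranges of degrees: in degree 0 and strictly between 0 and r the power Aʳ contributes
    -- nothing, and from r on the root equation applies.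
    root⇒expansion : (∀ i → 0 < i → i < r → a i ≈ 0#) →
                     ∀ A → A 0 ≈ 0# → tail A ^ r ≋ shifted → a ≋ const (a 0) ⊕ a r · A ^ r
    root⇒expansion gap A A₀≈0 _ zero = sym (begin
      a 0 + a r * (A ^ r) 0   ≈⟨ +-congˡ (*-congˡ (^-low A r A₀≈0 0 (s≤s z≤n))) ⟩
      a 0 + a r * 0#          ≈⟨ +-congˡ (zeroʳ _) ⟩
      a 0 + 0#                ≈⟨ +-identityʳ _ ⟩
      a 0                     ∎)
      where open ≈-Reasoning
    root⇒expansion gap A A₀≈0 p (suc i) with suc i ℕ.<? r
    ... | yes i<r = begin
      a (suc i)                     ≈⟨ gap (suc i) (s≤s z≤n) i<r ⟩
      0#                            ≈⟨ zeroʳ (a r) ⟨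
      a r * 0#                      ≈⟨ *-congˡ (^-low A r A₀≈0 (suc i) i<r) ⟨
      a r * (A ^ r) (suc i)         ≈⟨ +-identityˡ _ ⟨
      0# + a r * (A ^ r) (suc i)    ∎
      where open ≈-Reasoning
    ... | no i≮r with ℕ.m≤n⇒∃[o]m+o≡n (ℕ.≮⇒≥ i≮r)
    ...   | n , ≡.refl = begin
      a (r ℕ.+ n)                       ≈⟨ cancel-invertible (trans (*-comm _ _) wa≈1) _ ⟨
      a r * (w * a (r ℕ.+ n))           ≈⟨ *-congˡ (p n) ⟨
      a r * (tail A ^ r) n              ≈⟨ *-congˡ (^-tail A r A₀≈0 n) ⟨
      a r * (A ^ r) (r ℕ.+ n)           ≈⟨ +-identityˡ _ ⟨
      0# + a r * (A ^ r) (r ℕ.+ n)      ∎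
      where open ≈-Reasoning

corollary2p3 : ∀ {c ℓ₁ ℓ₂} (F : HeytingField c ℓ₁ ℓ₂) →
  let open HeytingField F
      open PowerSeries F
  in
  CharacteristicZero →
  (a : Series) (r : ℕ) → 0 < r →
  (∀ i → 0 < i → i < r → a i ≈ 0#) →
  a r # 0# →
  ∃! _≋_ (λ A → StartsWithX A × a ≋ const (a 0) ⊕ a r · A ^ r) ×
  (∀ A → StartsWithX A → a ≋ const (a 0) ⊕ a r · A ^ r →
    ∃[ Ā ] IsCompositionalInverse A Ā × StartsWithX Ā)
corollary2p3 F charZero a (suc k) _ gap aᵣ#0 =
  (A , ((refl , B₀≈1) , root⇒expansion a k w wa≈1 gap A refl Bʳ≋) , unique) ,
  (λ A startsWithX _ → compositional-inverse A startsWithX)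
  where
  open HeytingField F
  open PowerSeries F
  open SeriesProperties F
  w = proj₁ (invertible aᵣ#0)
  wa≈1 = proj₂ (invertible aᵣ#0)
  rootOfShift = root charZero k (shifted a k w wa≈1) (shifted-head a k w wa≈1)
  B₀≈1 = proj₁ (proj₂ rootOfShift)
  Bʳ≋ = proj₂ (proj₂ rootOfShift)
  A : Series
  -- This is x times the root, so `tail A` is the root by definition and the coefficient of x in `A`
  -- is the root's constant term.
  A = 0# ◂ proj₁ rootOfShift
  unique : ∀ {A′} → StartsWithX A′ × a ≋ const (a 0) ⊕ a (suc k) · A′ ^ suc k → A ≋ A′
  -- Both tails have constant term 1 and the same r-th power, `shifted`.
  unique {A′} ((A′₀≈0 , A′₁≈1) , a≋) = tail-injective A A′ (sym A′₀≈0)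
    (root-unique charZero k (tail A) (tail A′) B₀≈1 A′₁≈1
      (λ n → trans (Bʳ≋ n) (sym (expansion⇒root a k w wa≈1 A′ A′₀≈0 a≋ n))))
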